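{- Let $R$ be a commutative ring and $d\le n$. There is an algebraic branching program over $R$ that computes along the way every polynomial in $\{\mathrm{cpc}_{n',d'} : n'\le n,\ d'\le d\}$ and has width at most $\frac{n^2}{2}$ plus lower-order terms; in particular $\mathrm{w}(\{\mathrm{cpc}_{n',d'}\mid n'\le n,\ d'\le d\})\le \frac{n^2}{2}+\text{lower-order terms}$. The total number of vertices of this algebraic branching program is $\frac{dn^2}{2}-\frac{d^3}{6}$ plus lower-order terms, which for $d=n$ is $\frac{n^3}{3}$ plus lower-order terms.
   Context: $X_m=(x_{i,j})_{1\le i,j\le m}$ denotes the $m\times m$ matrix of indeterminates; $\mathrm{cpc}_{m,k}$ is defined by $\det(X_m+tI_m)=\sum_{k\ge0}\mathrm{cpc}_{m,m-k}t^k$, i.e. it is the sum of the $k\times k$ principal minors of $X_m$, a homogeneous polynomial of degree $k$. An algebraic branching program (ABP) is a directed acyclic graph whose vertices each lie in a layer $0,1,\dots,D$; each edge either joins two vertices of the same layer and is labeled by a constant in $R$ (constant edges), or goes from a vertex in layer $i$ to a vertex in layer $i+1$ and is labeled by a homogeneous linear polynomial over $R$. There is a distinguished source vertex $s$ in layer $0$. The ABP computes a polynomial $f$ at a vertex $v$ (computes $f$ along the way) if $f$ equals the sum, over all directed paths from $s$ to $v$, of the product of the edge labels along the path. The width of an ABP is the maximum number of vertices in any of the layers $1,\dots,D-1$. For a finite set $S$ of polynomials, $\mathrm{w}(S)$ is the smallest width of an ABP that computes every element of $S$ along the way (several sinks in the last layer are allowed). -}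

module Defs where

open import Level using (_⊔_)
open import Algebra.Bundles using (CommutativeRing)
open import Data.Nat using (ℕ; zero; suc; _≤_; _<_)
open import Data.Fin using (Fin; zero; suc; toℕ; fromℕ; inject₁; inject≤; punchIn) renaming (_≟_ to _≟F_)
open import Data.Vec using (Vec; []; _∷_; lookup)
import Data.Vec as Vec
open import Data.List using (List; []; _∷_; _++_; map; foldr; allFin; concatMap; length; filter)
open import Data.Product using (_×_; _,_; Σ)
open import Data.Bool using (Bool; true; false; not; if_then_else_)
open import Relation.Nullary.Decidable using (does)
open import Relation.Binary.PropositionalEquality using (_≡_)
import Data.Nat as ℕ

subsets : (m k : ℕ) → List (Vec (Fin m) k)
subsets zero    zero    = [] ∷ []
subsets zero    (suc k) = []
subsets (suc m) zero    = [] ∷ []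
subsets (suc m) (suc k) =
  map (Vec.map inject₁) (subsets m (suc k)) ++
  map (λ v → fromℕ m ∷ Vec.map inject₁ v) (subsets m k)

isEven : ℕ → Bool
isEven zero = true
isEven (suc i) = not (isEven i)

module _ {c ℓ} (R : CommutativeRing c ℓ) where
  private module R = CommutativeRing R

  -- The polynomial ring R[V]: terms modulo the congruence generated by
  -- the commutative-ring axioms and "constants form a ring homomorphic
  -- image of R" (i.e. the free commutative R-algebra on V).

  infixl 6 _⊕_
  infixl 7 _⊗_
  data Poly (V : Set) : Set c where
    con  : R.Carrier → Poly V
    var  : V → Poly V
    _⊕_  : Poly V → Poly V → Poly V
    _⊗_  : Poly V → Poly V → Poly V
    ⊖_   : Poly V → Poly V

  infix 4 _≋_
  data _≋_ {V : Set} : Poly V → Poly V → Set (c ⊔ ℓ) where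
    ≋-refl   : ∀ {p} → p ≋ p
    ≋-sym    : ∀ {p q} → p ≋ q → q ≋ p
    ≋-trans  : ∀ {p q r} → p ≋ q → q ≋ r → p ≋ r
    ⊕-cong   : ∀ {p p' q q'} → p ≋ p' → q ≋ q' → p ⊕ q ≋ p' ⊕ q'
    ⊗-cong   : ∀ {p p' q q'} → p ≋ p' → q ≋ q' → p ⊗ q ≋ p' ⊗ q'
    ⊖-cong   : ∀ {p q} → p ≋ q → ⊖ p ≋ ⊖ q
    ⊕-assoc  : ∀ p q r → (p ⊕ q) ⊕ r ≋ p ⊕ (q ⊕ r)
    ⊕-comm   : ∀ p q → p ⊕ q ≋ q ⊕ p
    ⊕-idˡ    : ∀ p → con R.0# ⊕ p ≋ p
    ⊕-invˡ   : ∀ p → (⊖ p) ⊕ p ≋ con R.0#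
    ⊗-assoc  : ∀ p q r → (p ⊗ q) ⊗ r ≋ p ⊗ (q ⊗ r)
    ⊗-comm   : ∀ p q → p ⊗ q ≋ q ⊗ p
    ⊗-idˡ    : ∀ p → con R.1# ⊗ p ≋ p
    distribʳ : ∀ p q r → (p ⊕ q) ⊗ r ≋ (p ⊗ r) ⊕ (q ⊗ r)
    con-cong : ∀ {a b} → a R.≈ b → con a ≋ con b
    con-+    : ∀ a b → con (a R.+ b) ≋ con a ⊕ con b
    con-*    : ∀ a b → con (a R.* b) ≋ con a ⊗ con b

  sumP : ∀ {V} → List (Poly V) → Poly V
  sumP = foldr _⊕_ (con R.0#)

  prodP : ∀ {V} → List (Poly V) → Poly V
  prodP = foldr _⊗_ (con R.1#)

  signed : ∀ {V} → ℕ → Poly V → Poly V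
  signed i p = if isEven i then p else ⊖ p

  det : ∀ {V} (k : ℕ) → (Fin k → Fin k → Poly V) → Poly V
  det zero    M = con R.1#
  det (suc k) M =
    sumP (map (λ i → signed (toℕ i) (M i zero ⊗ det k (λ a b → M (punchIn i a) (suc b))))
              (allFin (suc k)))

  -- Variables x_{i,j}, 0 ≤ i,j < n (X_m is the top-left m×m block of X_n).
  Var : ℕ → Set
  Var n = Fin n × Fin n

  cpc : (n m k : ℕ) → m ≤ n → Poly (Var n)
  cpc n m k m≤n =
    sumP (map (λ S → det k (λ a b → var (inject≤ (lookup S a) m≤n , inject≤ (lookup S b) m≤n)))
              (subsets m k))

  linForm : ∀ {n} → (Fin n → Fin n → R.Carrier) → Poly (Var n)
  linForm {n} a =
    sumP (concatMap (λ i → map (λ j → con (a i j) ⊗ var (i , j)) (allFin n)) (allFin n))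

  -- Algebraic branching programs in the variables x_{ij}, i,j<n.
  -- Vertices are Fin N, numbered along a topological order (every edge
  -- goes from a smaller to a larger index), which encodes acyclicity.

  data Edge (n N : ℕ) (layer : Fin N → ℕ) : Set c where
    constEdge : (u v : Fin N) → toℕ u < toℕ v → layer u ≡ layer v →
                R.Carrier → Edge n N layer
    linEdge   : (u v : Fin N) → toℕ u < toℕ v → layer v ≡ suc (layer u) →
                (Fin n → Fin n → R.Carrier) → Edge n N layer

  module _ {n N : ℕ} {layer : Fin N → ℕ} where
    source : Edge n N layer → Fin N
    source (constEdge u _ _ _ _) = u
    source (linEdge u _ _ _ _)   = u

    target : Edge n N layer → Fin N
    target (constEdge _ v _ _ _) = v
    target (linEdge _ v _ _ _)   = v

    label : Edge n N layer → Poly (Var n)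
    label (constEdge _ _ _ _ a) = con a
    label (linEdge _ _ _ _ a)   = linForm a

  record ABP (n : ℕ) : Set c where
    field
      D         : ℕ
      N         : ℕ
      layer     : Fin N → ℕ
      layer≤D   : ∀ v → layer v ≤ D
      src       : Fin N
      src-layer : layer src ≡ 0
      edges     : List (Edge n N layer)

    pathsFuel : ℕ → Fin N → List (List (Poly (Var n)))
    pathsFuel fuel v = start ++ extend fuel
      where
      start : List (List (Poly (Var n)))
      start = if does (v ≟F src) then [] ∷ [] else []
      extend : ℕ → List (List (Poly (Var n)))
      extend zero = []
      extend (suc f) =
        concatMap (λ e → if does (target e ≟F v)
                           then map (label e ∷_) (pathsFuel f (source e))
                           else [])
                  edges

    -- Every path has < N edges (indices strictly increase), so fuel N
    -- enumerates all paths from src to v.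
    paths : Fin N → List (List (Poly (Var n)))
    paths = pathsFuel N

    value : Fin N → Poly (Var n)
    value v = sumP (map prodP (paths v))

    layerSize : ℕ → ℕ
    layerSize i = length (filter (λ v → layer v ℕ.≟ i) (allFin N))

    WidthAtMost : ℕ → Set
    WidthAtMost w = ∀ i → 1 ≤ i → i < D → layerSize i ≤ w

  ComputesAlong : ∀ {n} → ABP n → Poly (Var n) → Set (c ⊔ ℓ)
  ComputesAlong A f = Σ (Fin (ABP.N A)) λ v → ABP.value A v ≋ f

{-# OPTIONS --safe #-}
-- Let x be the matrix of indeterminates, with indices starting at 0.  For h and c put
--   B k h c = Σ_U det x[h,U | c,U],
-- the sum over all k-subsets U of {0,…,h-1}; terms with c ∈ U vanish.  Splitting the
-- principal minors of X_{h+1} according to whether they use the last index gives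
--   cpc (h+1) (k+1) = cpc h (k+1) + B k h h.
-- Expanding det x[h,U | c,U] along column c and moving column u to the front in the
-- minor that belongs to row u ∈ U gives
--   B k h c = x_{h,c} cpc h k - Σ_{u<h} x_{u,c} B (k-1) h u.
-- These recursions are an ABP whose layer ℓ computes cpc h ℓ and B (ℓ-1) h u for u < h ≤ n.
-- For h < ℓ these vertices can be dropped, since cpc h ℓ = 0 and B (ℓ-1) h u only feeds
-- cpc (h+1) k with k > ℓ ≥ h+1; so layer ℓ has about (n² - ℓ²)/2 vertices.
module Submission where

open import Defs
open import Algebra.Bundles using (CommutativeRing)
open import Data.Bool using (true; false; if_then_else_; _∧_)
open import Data.Empty using (⊥)
open import Data.Fin using (Fin; zero; suc; toℕ; fromℕ; fromℕ<; inject₁; inject≤; punchIn) renaming (_≟_ to _≟F_)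
open import Data.Fin.Properties using (toℕ-inject₁; toℕ-inject≤; toℕ-fromℕ; toℕ-fromℕ<; toℕ-injective; toℕ<n)
open import Data.List using (List; []; _∷_; _++_; map; foldr; tabulate; allFin; concatMap; downFrom; length; filter)
open import Data.List.Membership.Propositional using (_∈_)
open import Data.List.Properties using (tabulate-cong; map-tabulate; map-++; map-∘; map-cong)
open import Data.List.Relation.Unary.All using (All; []; _∷_)
open import Data.List.Relation.Unary.All.Properties using (++⁺)
open import Data.List.Relation.Unary.Any using (here; there)
open import Data.Nat using (ℕ; zero; suc; _≤_; _<_; _≟_; _≤?_; _<?_; z≤n; s≤s)
open import Data.Nat.Properties using (m<n⇒m<1+n; <⇒≤; ≤-trans; ≤-pred; m≤n⇒m<n∨m≡n; ≤-refl; m≤m+n; <-≤-trans; +-monoʳ-<; <-cmp; <⇒≢; +-cancelˡ-≡; +-cancelˡ-<; m+[n∸m]≡n; ≮⇒≥; <-trans; n<1+n; <⇒≱; ≰⇒>; m≤n⇒m≤1+n; +-monoʳ-≤; m≤n⇒∃[o]m+o≡n; *-mono-≤; *-monoʳ-≤; n≤1+n; ≤-reflexive; module ≤-Reasoning)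
open import Data.Nat.Tactic.RingSolver using (solve-∀)
open import Data.Product using (Σ; _×_; _,_; proj₁; proj₂)
open import Data.Sum using (inj₁; inj₂)
open import Data.Vec using (Vec; lookup)
import Data.Vec as Vec
open import Data.Vec.Properties using (lookup-map)
open import Function using (_∘_; id)
open import Level using (_⊔_)
open import Relation.Binary.Bundles using (Setoid)
open import Relation.Binary.Definitions using (tri<; tri≈; tri>)
open import Relation.Binary.PropositionalEquality as ≡ using (_≡_; _≢_)
open import Relation.Nullary.Decidable using (does; yes; no; dec-true; dec-false)
open import Relation.Nullary.Negation using (contradiction)
open import Relation.Unary using (Pred; Decidable)

-- Subsets of initial segments as decreasing lists; finite sums in a commutative ring.

subs : ℕ → ℕ → List (List ℕ)
subs m       zero    = [] ∷ []
subs zero    (suc k) = []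
subs (suc m) (suc k) = subs m (suc k) ++ map (m ∷_) (subs m k)

subs-> : ∀ {m k} → m < k → subs m k ≡ []
subs-> {zero}  {suc k} _ = ≡.refl
subs-> {suc m} {suc k} (s≤s m<k)
  rewrite subs-> {m} {suc k} (m<n⇒m<1+n m<k) | subs-> m<k = ≡.refl

module Sums {a ℓ} (A : CommutativeRing a ℓ) where
  open CommutativeRing A hiding (zero)
  open import Algebra.Properties.Ring ring
    using (-0#≈0#; -‿+-comm)
  open import Algebra.Properties.CommutativeSemigroup +-commutativeSemigroup
    using (interchange)

  ∑ : ∀ {i} {I : Set i} → List I → (I → Carrier) → Carrier
  ∑ is f = foldr _+_ 0# (map f is)

  module _ {i} {I : Set i} where
    ∑-cong : ∀ (is : List I) {f g} → (∀ i → f i ≈ g i) → ∑ is f ≈ ∑ is g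
    ∑-cong []       e = refl
    ∑-cong (i ∷ is) e = +-cong (e i) (∑-cong is e)

    ∑-zero : ∀ (is : List I) {f} → (∀ i → f i ≈ 0#) → ∑ is f ≈ 0#
    ∑-zero []       e = refl
    ∑-zero (i ∷ is) e = trans (+-cong (e i) (∑-zero is e)) (+-identityʳ 0#)

    ∑-++ : ∀ (is js : List I) f → ∑ (is ++ js) f ≈ ∑ is f + ∑ js f
    ∑-++ []       js f = sym (+-identityˡ _)
    ∑-++ (i ∷ is) js f = trans (+-congˡ (∑-++ is js f)) (sym (+-assoc _ _ _))

    ∑-+ : ∀ (is : List I) f g → ∑ is (λ i → f i + g i) ≈ ∑ is f + ∑ is g
    ∑-+ []       f g = sym (+-identityʳ 0#)
    ∑-+ (i ∷ is) f g = trans (+-congˡ (∑-+ is f g)) (interchange _ _ _ _)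

    ∑-neg : ∀ (is : List I) f → ∑ is (λ i → - f i) ≈ - ∑ is f
    ∑-neg []       f = sym -0#≈0#
    ∑-neg (i ∷ is) f = trans (+-congˡ (∑-neg is f)) (-‿+-comm _ _)

    ∑-*ˡ : ∀ (is : List I) x f → ∑ is (λ i → x * f i) ≈ x * ∑ is f
    ∑-*ˡ []       x f = sym (zeroʳ x)
    ∑-*ˡ (i ∷ is) x f = trans (+-congˡ (∑-*ˡ is x f)) (sym (distribˡ _ _ _))

  ∑-map : ∀ {i j} {I : Set i} {J : Set j} (φ : I → J) (is : List I) f →
          ∑ (map φ is) f ≈ ∑ is (λ i → f (φ i))
  ∑-map φ []       f = refl
  ∑-map φ (i ∷ is) f = +-congˡ (∑-map φ is f)

  ∑-swap : ∀ {i j} {I : Set i} {J : Set j} (is : List I) (js : List J) (f : I → J → Carrier) →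
           ∑ is (λ i → ∑ js (f i)) ≈ ∑ js (λ j → ∑ is (λ i → f i j))
  ∑-swap []       js f = sym (∑-zero js (λ _ → refl))
  ∑-swap (i ∷ is) js f = trans (+-congˡ (∑-swap is js f)) (sym (∑-+ js _ _))

  ∑-tabulate : ∀ {i} {I : Set i} {n} (φ : Fin n → I) f → ∑ (tabulate φ) f ≡ ∑ (allFin n) (f ∘ φ)
  ∑-tabulate φ f = ≡.cong (foldr _+_ 0#)
    (≡.trans (map-tabulate φ f) (≡.sym (map-tabulate id (f ∘ φ))))

  ∑-concatMap : ∀ {i j} {I : Set i} {J : Set j} (φ : I → List J) is f →
    ∑ (concatMap φ is) f ≈ ∑ is (λ i → ∑ (φ i) f)
  ∑-concatMap φ []       f = refl
  ∑-concatMap φ (i ∷ is) f = trans (∑-++ (φ i) _ f) (+-congˡ (∑-concatMap φ is f))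

  ∑-indicator : ∀ {n} (v : Fin n) f → (∀ i → i ≢ v → f i ≈ 0#) → ∑ (allFin n) f ≈ f v
  ∑-indicator {suc n} zero f f0 = trans
    (+-congˡ (trans (reflexive (∑-tabulate suc f)) (∑-zero (allFin n) (λ i → f0 (suc i) λ ()))))
    (+-identityʳ _)
  ∑-indicator {suc n} (suc v) f f0 = trans
    (+-cong (f0 zero λ ()) (trans (reflexive (∑-tabulate suc f))
      (∑-indicator v (f ∘ suc) (λ i i≢v → f0 (suc i) λ { ≡.refl → i≢v ≡.refl }))))
    (+-identityˡ _)

-- Minors indexed by lists, and the recursions for principal and bordered sums.

module Minors {a ℓ} (A : CommutativeRing a ℓ)
              (x : ℕ → ℕ → CommutativeRing.Carrier A) where
  open CommutativeRing A hiding (zero)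
  open Sums A
  open import Algebra.Properties.Ring ring
    using (-0#≈0#; -‿+-comm; -‿distribˡ-*; -‿distribʳ-*; +-inverseˡ-unique)
  open import Algebra.Properties.CommutativeSemigroup +-commutativeSemigroup
    using (interchange; x∙yz≈y∙xz)
  open import Algebra.Properties.CommutativeSemigroup *-commutativeSemigroup
    using () renaming (x∙yz≈y∙xz to *-x∙yz≈y∙xz)
  open import Relation.Binary.Reasoning.Setoid setoid

  -- Both range over the ways to pick one entry of a list. `F` receives the picked entry and the
  -- others in their original order, since a skipped head is put back in front. The nested minus
  -- signs of `∑±` amount to the sign (-1)^i for the entry at place i, as in a Laplace expansion.
  ∑± ∑⁺ : (ℕ → List ℕ → Carrier) → List ℕ → Carrier
  ∑± F []       = 0#
  ∑± F (r ∷ rs) = F r rs + - ∑± (λ s ss → F s (r ∷ ss)) rs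
  ∑⁺ F []       = 0#
  ∑⁺ F (r ∷ rs) = F r rs + ∑⁺ (λ s ss → F s (r ∷ ss)) rs

  ∑±-cong : ∀ {F G} → (∀ r rs → F r rs ≈ G r rs) → ∀ rs → ∑± F rs ≈ ∑± G rs
  ∑±-cong e []       = refl
  ∑±-cong e (r ∷ rs) = +-cong (e r rs) (-‿cong (∑±-cong (λ s ss → e s (r ∷ ss)) rs))

  ∑⁺-cong : ∀ {F G} → (∀ r rs → F r rs ≈ G r rs) → ∀ rs → ∑⁺ F rs ≈ ∑⁺ G rs
  ∑⁺-cong e []       = refl
  ∑⁺-cong e (r ∷ rs) = +-cong (e r rs) (∑⁺-cong (λ s ss → e s (r ∷ ss)) rs)

  ∑±-zero : ∀ {F} → (∀ r rs → F r rs ≈ 0#) → ∀ rs → ∑± F rs ≈ 0#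
  ∑±-zero e []       = refl
  ∑±-zero e (r ∷ rs) = trans (+-cong (e r rs)
    (trans (-‿cong (∑±-zero (λ s ss → e s (r ∷ ss)) rs)) -0#≈0#)) (+-identityʳ 0#)

  ∑±-+ : ∀ F G rs → ∑± (λ r ss → F r ss + G r ss) rs ≈ ∑± F rs + ∑± G rs
  ∑±-+ F G []       = sym (+-identityʳ 0#)
  ∑±-+ F G (r ∷ rs) = trans
    (+-congˡ (trans (-‿cong (∑±-+ _ _ rs)) (sym (-‿+-comm _ _))))
    (interchange _ _ _ _)

  ∑±-neg : ∀ F rs → ∑± (λ r ss → - F r ss) rs ≈ - ∑± F rs
  ∑±-neg F []       = sym -0#≈0#
  ∑±-neg F (r ∷ rs) = trans (+-congˡ (-‿cong (∑±-neg _ rs))) (-‿+-comm _ _)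

  ∑±-*ˡ : ∀ x F rs → ∑± (λ r ss → x * F r ss) rs ≈ x * ∑± F rs
  ∑±-*ˡ x F []       = sym (zeroʳ x)
  ∑±-*ˡ x F (r ∷ rs) = trans
    (+-congˡ (trans (-‿cong (∑±-*ˡ x _ rs)) (-‿distribʳ-* _ _)))
    (sym (distribˡ _ _ _))

  ∑±∑± : (ℕ → ℕ → List ℕ → Carrier) → List ℕ → Carrier
  ∑±∑± g = ∑± (λ r → ∑± (g r))

  -- Picking r and then s leaves the same rest as picking s and then r, but with the opposite sign.
  -- In the induction the pairs that pick the head first cancel those that pick it second.
  ∑±∑±-symmetric : ∀ g → (∀ r s ss → g r s ss ≈ g s r ss) → ∀ rs → ∑±∑± g rs ≈ 0#
  ∑±∑±-symmetric g e []       = refl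
  ∑±∑±-symmetric g e (r ∷ rs) = begin
    ∑± (g r) rs + - ∑± (λ s ss → g s r ss + - ∑± (λ t ts → g s t (r ∷ ts)) ss) rs
      ≈⟨ +-congˡ (-‿cong (∑±-+ _ _ rs)) ⟩
    ∑± (g r) rs + - (∑± (λ s → g s r) rs + ∑± (λ s ss → - ∑± (λ t ts → g s t (r ∷ ts)) ss) rs)
      ≈⟨ +-congˡ (-‿cong (+-cong (∑±-cong (λ s ss → e s r ss) rs)
           (trans (∑±-neg _ rs) (trans (-‿cong rest≈0) -0#≈0#)))) ⟩
    ∑± (g r) rs + - (∑± (g r) rs + 0#)
      ≈⟨ +-congˡ (-‿cong (+-identityʳ _)) ⟩
    ∑± (g r) rs + - ∑± (g r) rs
      ≈⟨ -‿inverseʳ _ ⟩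
    0# ∎
    where
    rest≈0 : ∑±∑± (λ s t ts → g s t (r ∷ ts)) rs ≈ 0#
    rest≈0 = ∑±∑±-symmetric _ (λ s t ts → e s t (r ∷ ts)) rs

  -- For lists of equal length this is the determinant of the submatrix with rows `rs` and columns
  -- `cs`, expanded along the first listed column. The lists need not be sorted or free of
  -- repetitions, so columns can be permuted and repeated.
  minor : List ℕ → List ℕ → Carrier
  minor rs []       = 1#
  minor rs (c ∷ cs) = ∑± (λ r ss → x r c * minor ss cs) rs

  private
    minor₂ : ∀ c d cs rs →
      minor rs (c ∷ d ∷ cs) ≈ ∑±∑± (λ r s ss → x r c * (x s d * minor ss cs)) rs
    minor₂ c d cs = ∑±-cong (λ r rs → sym (∑±-*ˡ _ _ rs))

  -- Expansion removes the prefix. At the front, the sum of the two minors is a double expansion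
  -- whose summand is symmetric in the two picked rows, hence zero.
  minor-swap : ∀ rs pre c d cs →
    minor rs (pre ++ c ∷ d ∷ cs) ≈ - minor rs (pre ++ d ∷ c ∷ cs)
  minor-swap rs (b ∷ pre) c d cs = trans
    (∑±-cong (λ r ss → trans (*-congˡ (minor-swap ss pre c d cs)) (sym (-‿distribʳ-* _ _))) rs)
    (∑±-neg _ rs)
  minor-swap rs [] c d cs = +-inverseˡ-unique _ _ (begin
    minor rs (c ∷ d ∷ cs) + minor rs (d ∷ c ∷ cs)
      ≈⟨ +-cong (minor₂ c d cs rs) (minor₂ d c cs rs) ⟩
    ∑±∑± (λ r s ss → x r c * (x s d * minor ss cs)) rs +
    ∑±∑± (λ r s ss → x r d * (x s c * minor ss cs)) rs
      ≈⟨ ∑±-+ _ _ rs ⟨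
    ∑± (λ r ss → ∑± (λ s ts → x r c * (x s d * minor ts cs)) ss +
                 ∑± (λ s ts → x r d * (x s c * minor ts cs)) ss) rs
      ≈⟨ ∑±-cong (λ r ss → ∑±-+ _ _ ss) rs ⟨
    ∑±∑± (λ r s ss → x r c * (x s d * minor ss cs) + x r d * (x s c * minor ss cs)) rs
      ≈⟨ ∑±∑±-symmetric _ (λ r s ss → trans (+-comm _ _)
           (+-cong (*-x∙yz≈y∙xz _ _ _) (*-x∙yz≈y∙xz _ _ _))) rs ⟩
    0# ∎)

  -- Adjacent equal columns make the double expansion symmetric by itself; antisymmetry alone would
  -- only show that twice the minor vanishes. Otherwise a swap brings another column to the front,
  -- and expanding along it leaves minors in which the repeated column has moved closer to its copy.
  minor-repeat : ∀ rs {c cs} → c ∈ cs → minor rs (c ∷ cs) ≈ 0#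
  minor-repeat rs {c} {_ ∷ cs} (here ≡.refl) = trans (minor₂ c c cs rs)
    (∑±∑±-symmetric _ (λ r s ss → *-x∙yz≈y∙xz _ _ _) rs)
  minor-repeat rs {c} {d ∷ cs} (there c∈cs) = begin
    minor rs (c ∷ d ∷ cs)    ≈⟨ minor-swap rs [] c d cs ⟩
    - minor rs (d ∷ c ∷ cs)  ≈⟨ -‿cong (∑±-zero (λ r ss →
                                  trans (*-congˡ (minor-repeat ss c∈cs)) (zeroʳ _)) rs) ⟩
    - 0#                     ≈⟨ -0#≈0# ⟩
    0#                       ∎

  -- Moving column u to the front costs the sign with which row u is picked.
  ∑±⇒∑⁺ : ∀ (F : ℕ → List ℕ → List ℕ → Carrier) →
    (∀ u rs pre c d cs → F u rs (pre ++ c ∷ d ∷ cs) ≈ - F u rs (pre ++ d ∷ c ∷ cs)) →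
    ∀ us → ∑± (λ u rs → F u rs us) us ≈ ∑⁺ (λ u rs → F u rs (u ∷ rs)) us
  ∑±⇒∑⁺ F alt []       = refl
  ∑±⇒∑⁺ F alt (r ∷ us) = +-congˡ (begin
    - ∑± (λ u rs → F u (r ∷ rs) (r ∷ us)) us
      ≈⟨ ∑±-neg _ us ⟨
    ∑± (λ u rs → - F u (r ∷ rs) (r ∷ us)) us
      -- The skipped `r` stays in front of both rows and columns, so the induction hypothesis is
      -- used for a modified `F`. The swap that then moves `u` past `r` absorbs the minus sign.
      ≈⟨ ∑±⇒∑⁺ (λ u rs cs → - F u (r ∷ rs) (r ∷ cs))
           (λ u rs pre c d cs → -‿cong (alt u (r ∷ rs) (r ∷ pre) c d cs)) us ⟩
    ∑⁺ (λ u rs → - F u (r ∷ rs) (r ∷ u ∷ rs)) us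
      ≈⟨ ∑⁺-cong (λ u rs → alt u (r ∷ rs) [] u r rs) us ⟨
    ∑⁺ (λ u rs → F u (r ∷ rs) (u ∷ r ∷ rs)) us ∎)

  -- Removing an element u from a (k+1)-subset leaves a k-subset not containing u,
  -- and the k-subsets that do contain u contribute nothing.
  ∑⁺-subs : ∀ m k (F : ℕ → List ℕ → Carrier) → (∀ u us → u ∈ us → F u us ≈ 0#) →
    ∑ (subs m (suc k)) (∑⁺ F) ≈ ∑ (subs m k) (λ us → ∑ (downFrom m) (λ u → F u us))
  ∑⁺-subs zero    k       F F0 = sym (∑-zero (subs zero k) (λ _ → refl))
  ∑⁺-subs (suc m) zero    F F0 = begin
    ∑ (subs m 1 ++ map (m ∷_) ([] ∷ [])) (∑⁺ F)
      ≈⟨ ∑-++ (subs m 1) _ _ ⟩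
    ∑ (subs m 1) (∑⁺ F) + ((F m [] + 0#) + 0#)
      ≈⟨ +-cong (trans (∑⁺-subs m zero F F0) (+-identityʳ _)) (trans (+-identityʳ _) (+-identityʳ _)) ⟩
    ∑ (downFrom m) (λ u → F u []) + F m []
      ≈⟨ +-comm _ _ ⟩
    F m [] + ∑ (downFrom m) (λ u → F u [])
      ≈⟨ +-identityʳ _ ⟨
    F m [] + ∑ (downFrom m) (λ u → F u []) + 0# ∎
  ∑⁺-subs (suc m) (suc k) F F0 = begin
    ∑ (subs (suc m) (suc (suc k))) (∑⁺ F)
      ≈⟨ ∑-++ (subs m (suc (suc k))) _ _ ⟩
    ∑ (subs m (suc (suc k))) (∑⁺ F) + ∑ (map (m ∷_) (subs m (suc k))) (∑⁺ F)
      ≈⟨ +-cong (∑⁺-subs m (suc k) F F0) (∑-map (m ∷_) (subs m (suc k)) _) ⟩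
    α + ∑ (subs m (suc k)) (λ us → F m us + ∑⁺ (λ u rs → F u (m ∷ rs)) us)
      ≈⟨ +-congˡ (trans (∑-+ (subs m (suc k)) _ _) (+-congˡ
           (∑⁺-subs m k (λ u rs → F u (m ∷ rs)) (λ u us u∈us → F0 u (m ∷ us) (there u∈us))))) ⟩
    α + (∑ (subs m (suc k)) (F m) + β)
      ≈⟨ x∙yz≈y∙xz _ _ _ ⟩
    ∑ (subs m (suc k)) (F m) + (α + β)
      ≈⟨ +-assoc _ _ _ ⟨
    ∑ (subs m (suc k)) (F m) + α + β
      -- Read from the right-hand side: for a subset containing `m`, the summand with u equal to `m`
      -- vanishes by `F0`, and the others make up `β`.
      ≈⟨ +-cong (∑-+ (subs m (suc k)) _ _)
           (trans (∑-map (m ∷_) (subs m k) _) (∑-cong (subs m k) (λ us →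
              trans (+-congʳ (F0 m (m ∷ us) (here ≡.refl))) (+-identityˡ _)))) ⟨
    ∑ (subs m (suc k)) (λ us → F m us + ∑ (downFrom m) (λ u → F u us)) +
    ∑ (map (m ∷_) (subs m k)) (λ us → F m us + ∑ (downFrom m) (λ u → F u us))
      ≈⟨ ∑-++ (subs m (suc k)) _ _ ⟨
    ∑ (subs (suc m) (suc k)) (λ us → ∑ (downFrom (suc m)) (λ u → F u us)) ∎
    where
    α β : Carrier
    α = ∑ (subs m (suc k)) (λ us → ∑ (downFrom m) (λ u → F u us))
    β = ∑ (subs m k) (λ us → ∑ (downFrom m) (λ u → F u (m ∷ us)))

  principal : ℕ → ℕ → Carrier
  principal m k = ∑ (subs m k) (λ us → minor us us)

  -- Denoted B k h c above.
  bordered : ℕ → ℕ → ℕ → Carrier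
  bordered k h c = ∑ (subs h k) (λ us → minor (h ∷ us) (c ∷ us))

  -- Shifted so that walk ℓ h u has degree ℓ and thus belongs to layer ℓ.
  walk : ℕ → ℕ → ℕ → Carrier
  walk zero    h u = 0#
  walk (suc k) h u = bordered k h u

  bordered-rec : ∀ k h c →
    bordered k h c ≈ x h c * principal h k + ∑ (downFrom h) (λ u → - x u c * walk k h u)
  bordered-rec zero h c = +-cong
    (trans (+-congˡ -0#≈0#) (trans (+-identityʳ _) (*-congˡ (sym (+-identityʳ _)))))
    (sym (∑-zero (downFrom h) (λ u → zeroʳ _)))
  bordered-rec (suc k) h c = begin
    ∑ S (λ us → x h c * minor us us + - ∑± (λ u rs → x u c * minor (h ∷ rs) us) us)
      ≈⟨ ∑-+ S _ _ ⟩
    ∑ S (λ us → x h c * minor us us) + ∑ S (λ us → - ∑± (λ u rs → x u c * minor (h ∷ rs) us) us)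
      ≈⟨ +-cong (∑-*ˡ S _ _) (trans (∑-neg S _) (-‿cong (∑-cong S
           (∑±⇒∑⁺ (λ u rs cs → x u c * minor (h ∷ rs) cs) alt)))) ⟩
    x h c * principal h (suc k) + - ∑ S (∑⁺ F)
      -- Picking `u` out of a (k+1)-subset is traded for an independent choice of `u` and a
      -- k-subset; the extra terms have column `u` twice and vanish.
      ≈⟨ +-congˡ (-‿cong (trans (∑⁺-subs h k F F0) (∑-swap (subs h k) (downFrom h) _))) ⟩
    x h c * principal h (suc k) + - ∑ (downFrom h) (λ u → ∑ (subs h k) (F u))
      ≈⟨ +-congˡ (trans (sym (∑-neg (downFrom h) _)) (∑-cong (downFrom h) (λ u →
           trans (-‿cong (∑-*ˡ (subs h k) _ _)) (-‿distribˡ-* _ _)))) ⟩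
    x h c * principal h (suc k) + ∑ (downFrom h) (λ u → - x u c * bordered k h u) ∎
    where
    S : List (List ℕ)
    S = subs h (suc k)
    F : ℕ → List ℕ → Carrier
    F u rs = x u c * minor (h ∷ rs) (u ∷ rs)
    F0 : ∀ u us → u ∈ us → F u us ≈ 0#
    F0 u us u∈us = trans (*-congˡ (minor-repeat (h ∷ us) u∈us)) (zeroʳ _)
    alt : ∀ u rs pre c' d cs → x u c * minor (h ∷ rs) (pre ++ c' ∷ d ∷ cs) ≈
                               - (x u c * minor (h ∷ rs) (pre ++ d ∷ c' ∷ cs))
    alt u rs pre c' d cs = trans (*-congˡ (minor-swap (h ∷ rs) pre c' d cs)) (sym (-‿distribʳ-* _ _))

  principal-rec : ∀ h k → principal (suc h) (suc k) ≈ principal h (suc k) + bordered k h h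
  principal-rec h k = trans (∑-++ (subs h (suc k)) _ _) (+-congˡ (∑-map (h ∷_) (subs h k) _))

  principal-zero : ∀ {h k} → h < k → principal h k ≈ 0#
  principal-zero h<k = reflexive (≡.cong (λ S → ∑ S (λ us → minor us us)) (subs-> h<k))

-- Polynomial terms as a commutative ring.

module _ {c ℓ} (R : CommutativeRing c ℓ) where
  private module R = CommutativeRing R

  polyRing : Set → CommutativeRing c (c ⊔ ℓ)
  polyRing V = record
    { Carrier = Poly R V
    ; _≈_ = _≋_ R
    ; _+_ = _⊕_
    ; _*_ = _⊗_
    ; -_ = ⊖_
    ; 0# = con R.0#
    ; 1# = con R.1#
    ; isCommutativeRing = record
      { isRing = record
        { +-isAbelianGroup = record
          { isGroup = record
            { isMonoid = record
              { isSemigroup = record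
                { isMagma = record
                  { isEquivalence = record { refl = ≋-refl ; sym = ≋-sym ; trans = ≋-trans }
                  ; ∙-cong = ⊕-cong
                  }
                ; assoc = ⊕-assoc
                }
              ; identity = ⊕-idˡ , comm∧idˡ⇒idʳ ⊕-comm ⊕-idˡ
              }
            ; inverse = ⊕-invˡ , comm∧invˡ⇒invʳ ⊕-comm ⊕-invˡ
            ; ⁻¹-cong = ⊖-cong
            }
          ; comm = ⊕-comm
          }
        ; *-cong = ⊗-cong
        ; *-assoc = ⊗-assoc
        ; *-identity = ⊗-idˡ , comm∧idˡ⇒idʳ ⊗-comm ⊗-idˡ
        ; distrib = comm∧distrʳ⇒distrˡ ⊕-cong ⊗-comm distr , distr
        }
      ; *-comm = ⊗-comm
      }
    }
    where
    ≋-setoid : Setoid c (c ⊔ ℓ)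
    ≋-setoid = record
      { Carrier = Poly R V ; _≈_ = _≋_ R
      ; isEquivalence = record { refl = ≋-refl ; sym = ≋-sym ; trans = ≋-trans } }
    open import Algebra.Consequences.Setoid ≋-setoid
    distr : ∀ r p q → _≋_ R ((p ⊕ q) ⊗ r) ((p ⊗ r) ⊕ (q ⊗ r))
    distr r p q = distribʳ p q r

  -- Indeterminates as linear forms, and determinants as minors.

  module LinearForms (n : ℕ) where
    private P = polyRing (Var R n)
    open CommutativeRing P hiding (zero)
    open Sums P
    open import Algebra.Properties.Ring (CommutativeRing.ring P) using (-‿distribˡ-*; +-inverseˡ-unique)
    open import Relation.Binary.Reasoning.Setoid setoid

    linForm-∑ : ∀ a → linForm R a ≈
      ∑ (allFin n) (λ i → ∑ (allFin n) (λ j → con (a i j) * var (i , j)))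
    linForm-∑ a = go (allFin n)
      where
      go : ∀ is → foldr _+_ 0# (concatMap (λ i → map (λ j → con (a i j) * var (i , j)) (allFin n)) is)
                  ≈ ∑ is (λ i → ∑ (allFin n) (λ j → con (a i j) * var (i , j)))
      go []       = refl
      go (i ∷ is) = trans (foldr-++ (map _ (allFin n)) _) (+-congˡ (go is))
        where
        foldr-++ : ∀ ps qs → foldr _+_ 0# (ps ++ qs) ≈ foldr _+_ 0# ps + foldr _+_ 0# qs
        foldr-++ []       qs = sym (+-identityˡ _)
        foldr-++ (p ∷ ps) qs = trans (+-congˡ (foldr-++ ps qs)) (sym (+-assoc _ _ _))

    -- The generators of `_≋_` make `con` respect sums and products but do not mention negation, so
    -- uniqueness of additive inverses is used.
    con-neg : ∀ r → con (R.- r) ≈ - con r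
    con-neg r = +-inverseˡ-unique _ _ (trans (sym (con-+ _ _)) (con-cong (R.-‿inverseˡ r)))

    linForm-neg : ∀ a → linForm R (λ i j → R.- a i j) ≈ - linForm R a
    linForm-neg a = begin
      linForm R (λ i j → R.- a i j)
        ≈⟨ linForm-∑ _ ⟩
      ∑ (allFin n) (λ i → ∑ (allFin n) (λ j → con (R.- a i j) * var (i , j)))
        ≈⟨ ∑-cong (allFin n) (λ i → trans
             (∑-cong (allFin n) (λ j → trans (*-congʳ (con-neg _)) (sym (-‿distribˡ-* _ _))))
             (∑-neg (allFin n) _)) ⟩
      ∑ (allFin n) (λ i → - ∑ (allFin n) (λ j → con (a i j) * var (i , j)))
        ≈⟨ ∑-neg (allFin n) _ ⟩
      - ∑ (allFin n) (λ i → ∑ (allFin n) (λ j → con (a i j) * var (i , j)))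
        ≈⟨ -‿cong (linForm-∑ a) ⟨
      - linForm R a ∎

    -- Coefficients of a single indeterminate, so that matrix entries are literally edge labels. The
    -- indices are natural numbers to match the lists in `subs`.
    unit : ℕ → ℕ → Fin n → Fin n → R.Carrier
    unit r s i j = if does (toℕ i ≟ r) ∧ does (toℕ j ≟ s) then R.1# else R.0#

    -- The indeterminate x_{r,s}, or 0 if r or s is out of range.
    entry : ℕ → ℕ → Poly R (Var R n)
    entry r s = linForm R (unit r s)

    entry-var : ∀ i j → entry (toℕ i) (toℕ j) ≈ var (i , j)
    entry-var i j = begin
      entry (toℕ i) (toℕ j)
        ≈⟨ linForm-∑ _ ⟩
      ∑ (allFin n) (λ i' → ∑ (allFin n) (λ j' → term i' j'))
        ≈⟨ ∑-indicator i _ (λ i' i'≢i → ∑-zero (allFin n) (λ j' →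
             trans (*-congʳ (reflexive (≡.cong con (row i' j' i'≢i)))) (zeroˡ _))) ⟩
      ∑ (allFin n) (λ j' → term i j')
        ≈⟨ ∑-indicator j _ (λ j' j'≢j →
             trans (*-congʳ (reflexive (≡.cong con (col j' j'≢j)))) (zeroˡ _)) ⟩
      term i j
        ≈⟨ trans (*-congʳ (reflexive (≡.cong con diag))) (*-identityˡ _) ⟩
      var (i , j) ∎
      where
      term : Fin n → Fin n → Poly R (Var R n)
      term i' j' = con (unit (toℕ i) (toℕ j) i' j') * var (i' , j')
      row : ∀ i' j' → i' ≢ i → unit (toℕ i) (toℕ j) i' j' ≡ R.0#
      row i' j' i'≢i rewrite dec-false (toℕ i' ≟ toℕ i) (i'≢i ∘ toℕ-injective) = ≡.refl
      col : ∀ j' → j' ≢ j → unit (toℕ i) (toℕ j) i j' ≡ R.0#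
      col j' j'≢j rewrite dec-true (toℕ i ≟ toℕ i) ≡.refl
                        | dec-false (toℕ j' ≟ toℕ j) (j'≢j ∘ toℕ-injective) = ≡.refl
      diag : unit (toℕ i) (toℕ j) i j ≡ R.1#
      diag rewrite dec-true (toℕ i ≟ toℕ i) ≡.refl | dec-true (toℕ j ≟ toℕ j) ≡.refl = ≡.refl

    open Minors P entry

    signed-suc : ∀ k p → signed R (suc k) p ≈ - signed R k p
    signed-suc k p with isEven k
    ... | true  = refl
    ... | false = sym (-‿involutive p)
      where open import Algebra.Properties.Ring (CommutativeRing.ring P) using (-‿involutive)

    -- `det` takes the sign from the parity of the index and deletes rows by `punchIn`, whereas `∑±`
    -- nests minus signs and restores skipped rows. Factoring one minus sign out of all terms after
    -- the first reconciles the two.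
    ∑±-tabulate : ∀ {k} (F : ℕ → List ℕ → Carrier) (f : Fin (suc k) → ℕ) →
      ∑ (allFin (suc k)) (λ i → signed R (toℕ i) (F (f i) (tabulate (f ∘ punchIn i))))
      ≈ ∑± F (tabulate f)
    ∑±-tabulate {k} F f = +-congˡ (begin
      ∑ (tabulate suc) (λ i → signed R (toℕ i) (F (f i) (tabulate (f ∘ punchIn i))))
        ≡⟨ ∑-tabulate {n = k} suc _ ⟩
      ∑ (allFin k) (λ i → signed R (suc (toℕ i)) (F (f (suc i)) (tabulate (f ∘ punchIn (suc i)))))
        ≈⟨ ∑-cong (allFin k) (λ i → signed-suc (toℕ i) _) ⟩
      ∑ (allFin k) (λ i → - signed R (toℕ i) (F (f (suc i)) (tabulate (f ∘ punchIn (suc i)))))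
        ≈⟨ ∑-neg (allFin k) _ ⟩
      - ∑ (allFin k) (λ i → signed R (toℕ i) (F (f (suc i)) (tabulate (f ∘ punchIn (suc i)))))
        ≈⟨ -‿cong (tail k F f) ⟩
      - ∑± (λ s ss → F s (f zero ∷ ss)) (tabulate (f ∘ suc)) ∎)
      where
      -- Splitting on `k` lets `tabulate (f ∘ punchIn (suc i))` reduce to a list with head `f zero`.
      tail : ∀ k F (f : Fin (suc k) → ℕ) →
        ∑ (allFin k) (λ i → signed R (toℕ i) (F (f (suc i)) (tabulate (f ∘ punchIn (suc i)))))
        ≈ ∑± (λ s ss → F s (f zero ∷ ss)) (tabulate (f ∘ suc))
      tail zero    F f = refl
      tail (suc k) F f = ∑±-tabulate (λ s ss → F s (f zero ∷ ss)) (f ∘ suc)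

    signed-cong : ∀ k {p q} → p ≈ q → signed R k p ≈ signed R k q
    signed-cong k e with isEven k
    ... | true  = e
    ... | false = -‿cong e

    -- Rows and columns have separate index functions because each expansion deletes an arbitrary
    -- row but always the first column.
    det-minor : ∀ k (f g : Fin k → ℕ) M → (∀ i j → M i j ≈ entry (f i) (g j)) →
      det R k M ≈ minor (tabulate f) (tabulate g)
    det-minor zero    f g M e = refl
    det-minor (suc k) f g M e = trans
      (∑-cong (allFin (suc k)) (λ i → signed-cong (toℕ i) (*-cong (e i zero)
        (det-minor k (f ∘ punchIn i) (g ∘ suc) _ (λ a b → e (punchIn i a) (suc b))))))
      (∑±-tabulate (λ r ss → entry r (g zero) * minor ss (tabulate (g ∘ suc))) f)

    members : ∀ {m k} → Vec (Fin m) k → List ℕ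
    members S = tabulate (toℕ ∘ lookup S)

    members-inject₁ : ∀ {m k} (S : Vec (Fin m) k) → members (Vec.map inject₁ S) ≡ members S
    members-inject₁ S = tabulate-cong (λ a →
      ≡.trans (≡.cong toℕ (lookup-map a inject₁ S)) (toℕ-inject₁ (lookup S a)))

    subsets-subs : ∀ m k → map members (subsets m k) ≡ subs m k
    subsets-subs zero    zero    = ≡.refl
    subsets-subs zero    (suc k) = ≡.refl
    subsets-subs (suc m) zero    = ≡.refl
    subsets-subs (suc m) (suc k) = ≡.trans (map-++ members (map (Vec.map inject₁) (subsets m (suc k))) _)
      (≡.cong₂ _++_
        (≡.trans (≡.sym (map-∘ (subsets m (suc k))))
          (≡.trans (map-cong members-inject₁ (subsets m (suc k))) (subsets-subs m (suc k))))
        (≡.trans (≡.sym (map-∘ (subsets m k)))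
          (≡.trans (map-cong (λ S → ≡.cong₂ _∷_ (toℕ-fromℕ m) (members-inject₁ S)) (subsets m k))
            (≡.trans (map-∘ (subsets m k)) (≡.cong (map (m ∷_)) (subsets-subs m k))))))

    cpc-principal : ∀ m k m≤n → cpc R n m k m≤n ≈ principal m k
    cpc-principal m k m≤n = begin
      cpc R n m k m≤n
        ≈⟨ ∑-cong (subsets m k) (λ S → det-minor k (toℕ ∘ lookup S) (toℕ ∘ lookup S) _ (λ a b →
             trans (sym (entry-var _ _)) (reflexive
               (≡.cong₂ entry (toℕ-inject≤ (lookup S a) m≤n) (toℕ-inject≤ (lookup S b) m≤n))))) ⟩
      ∑ (subsets m k) (λ S → minor (members S) (members S))
        ≈⟨ ∑-map members (subsets m k) (λ us → minor us us) ⟨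
      ∑ (map members (subsets m k)) (λ us → minor us us)
        ≡⟨ ≡.cong (λ S → ∑ S (λ us → minor us us)) (subsets-subs m k) ⟩
      principal m k ∎

  -- Values of a branching program from equations at its vertices.

  module Evaluation {n : ℕ} (A : ABP R n) where
    open ABP A
    private P = polyRing (Var R n)
    open CommutativeRing P hiding (zero)
    open Sums P
    open import Relation.Binary.Reasoning.Setoid setoid

    source<target : ∀ (e : Edge R n N layer) → toℕ (source R e) < toℕ (target R e)
    source<target (constEdge _ _ u<v _ _) = u<v
    source<target (linEdge _ _ u<v _ _)   = u<v

    source<v : ∀ (e : Edge R n N layer) {v} → target R e ≡ v → toℕ (source R e) < toℕ v
    source<v e ≡.refl = source<target e

    initial : Fin N → Carrier
    initial v = if does (v ≟F src) then 1# else 0#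

    -- The vertex equations, with edges grouped by target. Path sums are their only solution
    -- (`value-unique`), so a program can be verified vertex by vertex instead of path by path.
    Local : (Fin N → Carrier) → (Fin N → List (Edge R n N layer)) → Set _
    Local g es = ∀ v → g v ≈ initial v + ∑ (es v) (λ e → label R e * g (source R e))

    fuelValue : ℕ → Fin N → Carrier
    fuelValue f v = ∑ (pathsFuel f v) (prodP R)

    into : Fin N → (Fin N → Carrier) → Edge R n N layer → Carrier
    into v g e = if does (target R e ≟F v) then label R e * g (source R e) else 0#

    initial-∑ : ∀ v → ∑ (if does (v ≟F src) then [] ∷ [] else []) (prodP R) ≈ initial v
    initial-∑ v with does (v ≟F src)
    ... | true  = +-identityʳ _
    ... | false = refl

    fuelValue-zero : ∀ v → fuelValue zero v ≈ initial v
    fuelValue-zero v = trans (∑-++ (if does (v ≟F src) then [] ∷ [] else []) _ _)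
      (trans (+-identityʳ _) (initial-∑ v))

    fuelValue-suc : ∀ f v → fuelValue (suc f) v ≈ initial v + ∑ edges (into v (fuelValue f))
    fuelValue-suc f v = trans (∑-++ (if does (v ≟F src) then [] ∷ [] else []) _ _)
      (+-cong (initial-∑ v) (trans (∑-concatMap _ edges _) (∑-cong edges through)))
      where
      through : ∀ e → ∑ (if does (target R e ≟F v)
                           then map (label R e ∷_) (pathsFuel f (source R e)) else []) (prodP R)
                      ≈ into v (fuelValue f) e
      through e with does (target R e ≟F v)
      ... | true  = trans (∑-map (label R e ∷_) (pathsFuel f (source R e)) _)
                          (∑-*ˡ (pathsFuel f (source R e)) _ _)
      ... | false = refl

    module _ (es : Fin N → List (Edge R n N layer))
             (es-target : ∀ v → All (λ e → target R e ≡ v) (es v))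
             (edges≡ : edges ≡ concatMap es (allFin N)) where

      -- Only the block `es v` of the concatenation passes the test on targets, and it passes
      -- entirely.
      ∑-into : ∀ v g → ∑ edges (into v g) ≈ ∑ (es v) (λ e → label R e * g (source R e))
      ∑-into v g = begin
        ∑ edges (into v g)
          ≡⟨ ≡.cong (λ es → ∑ es (into v g)) edges≡ ⟩
        ∑ (concatMap es (allFin N)) (into v g)
          ≈⟨ ∑-concatMap es (allFin N) _ ⟩
        ∑ (allFin N) (λ w → ∑ (es w) (into v g))
          ≈⟨ ∑-indicator v _ (λ w w≢v → other w w≢v (es w) (es-target w)) ⟩
        ∑ (es v) (into v g)
          ≈⟨ same (es v) (es-target v) ⟩
        ∑ (es v) (λ e → label R e * g (source R e)) ∎
        where
        other : ∀ w → w ≢ v → ∀ es → All (λ e → target R e ≡ w) es → ∑ es (into v g) ≈ 0#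
        other w w≢v []       []            = refl
        other w w≢v (e ∷ es) (≡.refl ∷ ts) rewrite dec-false (target R e ≟F v) w≢v =
          trans (+-identityˡ _) (other w w≢v es ts)
        same : ∀ es → All (λ e → target R e ≡ v) es →
          ∑ es (into v g) ≈ ∑ es (λ e → label R e * g (source R e))
        same []       []            = refl
        same (e ∷ es) (≡.refl ∷ ts) rewrite dec-true (target R e ≟F target R e) ≡.refl =
          +-congˡ (same es ts)

      -- Edges raise the index, so a path ending in `v` has at most `toℕ v` edges and this much fuel
      -- finds all of them. With fuel zero, `v` has index 0 and no incoming edge.
      fuelValue-unique : ∀ {g} → Local g es → ∀ f v → toℕ v ≤ f → fuelValue f v ≈ g v
      fuelValue-unique {g} loc zero v v≤0 = begin
        fuelValue zero v
          ≈⟨ fuelValue-zero v ⟩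
        initial v
          ≈⟨ +-identityʳ _ ⟨
        initial v + 0#
          ≈⟨ +-congˡ (none (es v) (es-target v)) ⟨
        initial v + ∑ (es v) (λ e → label R e * g (source R e))
          ≈⟨ loc v ⟨
        g v ∎
        where
        none : ∀ es → All (λ e → target R e ≡ v) es →
          ∑ es (λ e → label R e * g (source R e)) ≈ 0#
        none []       []        = refl
        none (e ∷ es) (e→v ∷ _) = contradiction (≤-trans (source<v e e→v) v≤0) λ ()
      fuelValue-unique {g} loc (suc f) v v≤f = begin
        fuelValue (suc f) v
          ≈⟨ fuelValue-suc f v ⟩
        initial v + ∑ edges (into v (fuelValue f))
          ≈⟨ +-congˡ (∑-into v (fuelValue f)) ⟩
        initial v + ∑ (es v) (λ e → label R e * fuelValue f (source R e))
          ≈⟨ +-congˡ (sources (es v) (es-target v)) ⟩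
        initial v + ∑ (es v) (λ e → label R e * g (source R e))
          ≈⟨ loc v ⟨
        g v ∎
        where
        sources : ∀ es → All (λ e → target R e ≡ v) es →
          ∑ es (λ e → label R e * fuelValue f (source R e)) ≈ ∑ es (λ e → label R e * g (source R e))
        sources []       []         = refl
        sources (e ∷ es) (e→v ∷ ts) = +-cong
          (*-congˡ (fuelValue-unique loc f (source R e) (≤-pred (≤-trans (source<v e e→v) v≤f))))
          (sources es ts)

      value-unique : ∀ {g} → Local g es → ∀ v → value v ≈ g v
      value-unique loc v = fuelValue-unique loc N v (<⇒≤ (toℕ<n v))

-- Numbering the elements of consecutive blocks by partial sums.

open import Data.Nat using (_+_; _*_; _^_; _∸_)

partialSum : (ℕ → ℕ) → ℕ → ℕ
partialSum f zero    = 0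
partialSum f (suc k) = partialSum f k + f k

module _ (f : ℕ → ℕ) where
  partialSum-mono : ∀ {j k} → j ≤ k → partialSum f j ≤ partialSum f k
  partialSum-mono {j} {zero}  z≤n = ≤-refl
  partialSum-mono {j} {suc k} j≤k with m≤n⇒m<n∨m≡n j≤k
  ... | inj₁ (s≤s j≤k') = ≤-trans (partialSum-mono j≤k') (m≤m+n _ (f k))
  ... | inj₂ ≡.refl     = ≤-refl

  -- Element `x` of block `j` gets the number `partialSum f j + x`. This bound,
  -- `partialSum-injective` and `partialSum-find` make the numbering a bijection onto an initial
  -- segment; it is used for layers and again for the blocks within a layer.
  partialSum-< : ∀ {j k x} → j < k → x < f j → partialSum f j + x < partialSum f k
  partialSum-< {j} j<k x<fj = <-≤-trans (+-monoʳ-< (partialSum f j) x<fj) (partialSum-mono j<k)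

  partialSum-injective : ∀ {j j' x x'} → x < f j → x' < f j' →
    partialSum f j + x ≡ partialSum f j' + x' → j ≡ j' × x ≡ x'
  partialSum-injective {j} {j'} {x} {x'} x<fj x'<fj' eq with <-cmp j j'
  ... | tri< j<j' _ _ = contradiction eq
          (<⇒≢ (<-≤-trans (partialSum-< j<j' x<fj) (m≤m+n _ x')))
  ... | tri≈ _ ≡.refl _ = ≡.refl , +-cancelˡ-≡ (partialSum f j) x x' eq
  ... | tri> _ _ j'<j = contradiction (≡.sym eq)
          (<⇒≢ (<-≤-trans (partialSum-< j'<j x'<fj') (m≤m+n _ x)))

  partialSum-find : ∀ k {i} → i < partialSum f k →
    Σ ℕ λ j → Σ ℕ λ x → j < k × x < f j × i ≡ partialSum f j + x
  partialSum-find (suc k) {i} i<s with i <? partialSum f k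
  ... | yes i<s' = let j , x , j<k , x<fj , eq = partialSum-find k i<s'
                   in  j , x , m<n⇒m<1+n j<k , x<fj , eq
  ... | no  i≮s' = k , i ∸ partialSum f k , ≤-refl
                 , +-cancelˡ-< (partialSum f k) _ _ (≡.subst (_< partialSum f k + f k) eq i<s) , eq
    where
    eq : i ≡ partialSum f k + (i ∸ partialSum f k)
    eq = ≡.sym (m+[n∸m]≡n (≮⇒≥ i≮s'))

-- Induction on `N` slides the interval down: while its start is positive the first entry is not
-- kept, and from then on each kept entry uses up one unit of `l`.
length-filter-interval : ∀ {a p} {A : Set a} {P : Pred A p} (P? : Decidable P) N (f : Fin N → A) s l →
  (∀ i → P (f i) → s ≤ toℕ i × toℕ i < s + l) → length (filter P? (tabulate f)) ≤ l
length-filter-interval P? zero f s l range = z≤n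
length-filter-interval P? (suc N) f s l range with P? (f zero)
length-filter-interval P? (suc N) f zero zero range | yes p = contradiction (proj₂ (range zero p)) λ ()
length-filter-interval P? (suc N) f zero (suc l) range | yes p =
  s≤s (length-filter-interval P? N (f ∘ suc) 0 l (λ i q → z≤n , ≤-pred (proj₂ (range (suc i) q))))
length-filter-interval P? (suc N) f (suc s) l range | yes p = contradiction (proj₁ (range zero p)) λ ()
length-filter-interval P? (suc N) f zero l range | no _ =
  length-filter-interval P? N (f ∘ suc) 0 l (λ i q → z≤n , <-trans (n<1+n _) (proj₂ (range (suc i) q)))
length-filter-interval P? (suc N) f (suc s) l range | no _ =
  length-filter-interval P? N (f ∘ suc) s l
    (λ i q → let s≤i , i<s = range (suc i) q in ≤-pred s≤i , ≤-pred i<s)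

-- Vertex counts of blocks, layers and the whole program.

blockSize : ℕ → ℕ → ℕ
blockSize ℓ h = if does (ℓ ≤? h) then suc h else 0

blockSize-≤ : ∀ {ℓ h} → ℓ ≤ h → blockSize ℓ h ≡ suc h
blockSize-≤ {ℓ} {h} ℓ≤h rewrite dec-true (ℓ ≤? h) ℓ≤h = ≡.refl

blockSize-> : ∀ {ℓ h} → h < ℓ → blockSize ℓ h ≡ 0
blockSize-> {ℓ} {h} h<ℓ rewrite dec-false (ℓ ≤? h) (<⇒≱ h<ℓ) = ≡.refl

<blockSize⇒≤ : ∀ {ℓ h u} → u < blockSize ℓ h → ℓ ≤ h × u ≤ h
<blockSize⇒≤ {ℓ} {h} u<b with ℓ ≤? h
... | yes ℓ≤h = ℓ≤h , ≤-pred (≡.subst (_ <_) (blockSize-≤ ℓ≤h) u<b)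
... | no  ℓ≰h = contradiction (≡.subst (_ <_) (blockSize-> (≰⇒> ℓ≰h)) u<b) λ ()

blocks-≤ : ∀ ℓ h → h ≤ ℓ → partialSum (blockSize ℓ) h ≡ 0
blocks-≤ ℓ zero    _   = ≡.refl
blocks-≤ ℓ (suc h) h<ℓ = ≡.cong₂ _+_ (blocks-≤ ℓ h (<⇒≤ h<ℓ)) (blockSize-> h<ℓ)

-- The nonempty blocks start at `ℓ`, so the sum is a difference of triangular numbers. Doubling and
-- adding the subtracted one on the left avoids division and truncated subtraction.
2*blocks : ∀ ℓ h → ℓ ≤ h → 2 * partialSum (blockSize ℓ) h + ℓ * suc ℓ ≡ h * suc h
2*blocks ℓ h ℓ≤h with m≤n⇒m<n∨m≡n ℓ≤h
2*blocks ℓ h       _ | inj₂ ≡.refl rewrite blocks-≤ ℓ ℓ ≤-refl = ≡.refl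
2*blocks ℓ (suc h) _ | inj₁ (s≤s ℓ≤h) = begin
  2 * (s + blockSize ℓ h) + ℓ * suc ℓ  ≡⟨ ≡.cong (λ b → 2 * (s + b) + ℓ * suc ℓ) (blockSize-≤ ℓ≤h) ⟩
  2 * (s + suc h) + ℓ * suc ℓ          ≡⟨ rearrange s h (ℓ * suc ℓ) ⟩
  (2 * s + ℓ * suc ℓ) + 2 * suc h      ≡⟨ ≡.cong (_+ 2 * suc h) (2*blocks ℓ h ℓ≤h) ⟩
  h * suc h + 2 * suc h                ≡⟨ next h ⟩
  suc h * suc (suc h)                  ∎
  where
  open ≡.≡-Reasoning
  s = partialSum (blockSize ℓ) h
  rearrange : ∀ s h t → 2 * (s + suc h) + t ≡ (2 * s + t) + 2 * suc h
  rearrange = solve-∀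
  next : ∀ h → h * suc h + 2 * suc h ≡ suc h * suc (suc h)
  next = solve-∀

-- Heads run from 0 to `n` inclusive, hence `suc n`; likewise `suc d` for the layers in
-- `vertexCount`.
layerCount : ℕ → ℕ → ℕ
layerCount n ℓ = partialSum (blockSize ℓ) (suc n)

vertexCount : ℕ → ℕ → ℕ
vertexCount n d = partialSum (layerCount n) (suc d)

-- Summing `2*blocks` over the layers 0 to d and using that the numbers ℓ(ℓ+1) add up to
-- d(d+1)(d+2)/3; the factor 6 clears the denominators.
6*vertexCount : ∀ n d → d ≤ n →
  6 * vertexCount n d + d * suc d * suc (suc d) ≡ 3 * suc d * (suc n * suc (suc n))
6*vertexCount n zero _ = begin
  6 * layerCount n 0 + 0                ≡⟨ triple (layerCount n 0) ⟩
  3 * (2 * layerCount n 0 + 0 * 1)      ≡⟨ ≡.cong (3 *_) (2*blocks 0 (suc n) z≤n) ⟩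
  3 * (suc n * suc (suc n))             ∎
  where
  open ≡.≡-Reasoning
  triple : ∀ l → 6 * l + 0 ≡ 3 * (2 * l + 0 * 1)
  triple = solve-∀
6*vertexCount n (suc d) d<n = begin
  6 * (s + l) + suc d * suc (suc d) * suc (suc (suc d))
    ≡⟨ rearrange s l d ⟩
  (6 * s + d * suc d * suc (suc d)) + 3 * (2 * l + suc d * suc (suc d))
    ≡⟨ ≡.cong₂ (λ p q → p + 3 * q) (6*vertexCount n d (<⇒≤ d<n))
         (2*blocks (suc d) (suc n) (m≤n⇒m≤1+n d<n)) ⟩
  3 * suc d * (suc n * suc (suc n)) + 3 * (suc n * suc (suc n))
    ≡⟨ collect d (suc n * suc (suc n)) ⟩
  3 * suc (suc d) * (suc n * suc (suc n)) ∎
  where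
  open ≡.≡-Reasoning
  s = vertexCount n d
  l = layerCount n (suc d)
  rearrange : ∀ s l d → 6 * (s + l) + suc d * suc (suc d) * suc (suc (suc d)) ≡
    (6 * s + d * suc d * suc (suc d)) + 3 * (2 * l + suc d * suc (suc d))
  rearrange = solve-∀
  collect : ∀ d m → 3 * suc d * m + 3 * m ≡ 3 * suc (suc d) * m
  collect = solve-∀

layerCount-bound : ∀ n ℓ → ℓ ≤ n → 2 * layerCount n ℓ ≤ n * n + 12 * suc n
layerCount-bound n ℓ ℓ≤n = begin
  2 * layerCount n ℓ              ≤⟨ m≤m+n _ _ ⟩
  2 * layerCount n ℓ + ℓ * suc ℓ  ≡⟨ 2*blocks ℓ (suc n) (m≤n⇒m≤1+n ℓ≤n) ⟩
  suc n * suc (suc n)             ≤⟨ m≤m+n _ (9 * n + 10) ⟩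
  suc n * suc (suc n) + (9 * n + 10) ≡⟨ expand n ⟩
  n * n + 12 * suc n              ∎
  where
  open ≤-Reasoning
  expand : ∀ n → suc n * suc (suc n) + (9 * n + 10) ≡ n * n + 12 * suc n
  expand = solve-∀

vertexCount-upper : ∀ n d → d ≤ n →
  6 * vertexCount n d + d ^ 3 ≤ 3 * d * (n * n) + 12 * (suc n * suc n)
-- Writing n as d + e turns the slack into 9ne + 6e + 9n + 6, which has natural coefficients, so a
-- ring identity finishes the estimate.
vertexCount-upper n d d≤n with m≤n⇒∃[o]m+o≡n d≤n
... | e , ≡.refl = begin
  6 * s + d ^ 3                          ≤⟨ +-monoʳ-≤ (6 * s) (m≤m+n (d ^ 3) (3 * (d * d) + 2 * d)) ⟩
  6 * s + (d ^ 3 + (3 * (d * d) + 2 * d)) ≡⟨ ≡.cong (6 * s +_) (cube d) ⟩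
  6 * s + d * suc d * suc (suc d)        ≡⟨ 6*vertexCount n d d≤n ⟩
  3 * suc d * (suc n * suc (suc n))      ≤⟨ m≤m+n _ _ ⟩
  3 * suc d * (suc n * suc (suc n)) + (9 * (n * e) + 6 * e + 9 * n + 6) ≡⟨ expand d e ⟩
  3 * d * (n * n) + 12 * (suc n * suc n) ∎
  where
  open ≤-Reasoning
  s = vertexCount n d
  cube : ∀ d → d * (d * (d * 1)) + (3 * (d * d) + 2 * d) ≡ d * suc d * suc (suc d)
  cube = solve-∀
  expand : ∀ d e → 3 * suc d * (suc (d + e) * suc (suc (d + e))) + (9 * ((d + e) * e) + 6 * e + 9 * (d + e) + 6)
                   ≡ 3 * d * ((d + e) * (d + e)) + 12 * (suc (d + e) * suc (d + e))
  expand = solve-∀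

vertexCount-lower : ∀ n d → d ≤ n →
  3 * d * (n * n) ≤ 6 * vertexCount n d + d ^ 3 + 12 * (suc n * suc n)
vertexCount-lower n d d≤n = begin
  3 * d * (n * n)                        ≤⟨ *-mono-≤ (*-monoʳ-≤ 3 (n≤1+n d)) (*-mono-≤ (n≤1+n n) (m≤n⇒m≤1+n (n≤1+n n))) ⟩
  3 * suc d * (suc n * suc (suc n))      ≡⟨ 6*vertexCount n d d≤n ⟨
  6 * s + d * suc d * suc (suc d)        ≤⟨ +-monoʳ-≤ (6 * s) (m≤m+n _ (9 * (d * d) + 22 * d + 12)) ⟩
  6 * s + (d * suc d * suc (suc d) + (9 * (d * d) + 22 * d + 12)) ≡⟨ expand s d ⟩
  6 * s + d ^ 3 + 12 * (suc d * suc d)   ≤⟨ +-monoʳ-≤ (6 * s + d ^ 3) (*-monoʳ-≤ 12 (*-mono-≤ (s≤s d≤n) (s≤s d≤n))) ⟩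
  6 * s + d ^ 3 + 12 * (suc n * suc n)   ∎
  where
  open ≤-Reasoning
  s = vertexCount n d
  expand : ∀ s d → 6 * s + (d * suc d * suc (suc d) + (9 * (d * d) + 22 * d + 12)) ≡
                   6 * s + d * (d * (d * 1)) + 12 * (suc d * suc d)
  expand = solve-∀

-- Vertices and their topological numbering.

module Vertices (n d : ℕ) where

  record Vertex : Set where
    constructor vertex
    field
      level head current : ℕ
      level≤d      : level ≤ d
      level≤head   : level ≤ head
      head≤n       : head ≤ n
      current≤head : current ≤ head

    offset : ℕ
    offset = partialSum (blockSize level) head + current

    -- The rank in the lexicographic order by level, head and current. This order is topological:
    -- linear edges raise the level, constant edges keep it and raise the head.
    position : ℕ
    position = partialSum (layerCount n) level + offset

    current<blockSize : current < blockSize level head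
    current<blockSize = ≡.subst (current <_) (≡.sym (blockSize-≤ level≤head)) (s≤s current≤head)

    offset<layerCount : offset < layerCount n level
    offset<layerCount = partialSum-< (blockSize level) (s≤s head≤n) current<blockSize

    position<N : position < vertexCount n d
    position<N = partialSum-< (layerCount n) (s≤s level≤d) offset<layerCount

  open Vertex

  position-injective : ∀ v w → position v ≡ position w →
    level v ≡ level w × head v ≡ head w × current v ≡ current w
  position-injective v w eq
    with partialSum-injective (layerCount n) {level v} {level w} (offset<layerCount v) (offset<layerCount w) eq
  position-injective v@(vertex _ _ _ _ _ _ _) w@(vertex _ _ _ _ _ _ _) _ | ≡.refl , eq
    = ≡.refl , partialSum-injective (blockSize (level v)) {head v} {head w}
        (current<blockSize v) (current<blockSize w) eq

  position-level-< : ∀ v w → level v < level w → position v < position w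
  position-level-< v w lt = <-≤-trans (partialSum-< (layerCount n) lt (offset<layerCount v)) (m≤m+n _ _)

  position-head-< : ∀ v w → level v ≡ level w → head v < head w → position v < position w
  position-head-< v@(vertex _ _ _ _ _ _ _) w@(vertex _ _ _ _ _ _ _) ≡.refl lt =
    +-monoʳ-< (partialSum (layerCount n) (level v))
      (<-≤-trans (partialSum-< (blockSize (level v)) lt (current<blockSize v)) (m≤m+n _ _))

  encode : Vertex → Fin (vertexCount n d)
  encode v = fromℕ< (position<N v)

  toℕ-encode : ∀ v → toℕ (encode v) ≡ position v
  toℕ-encode v = toℕ-fromℕ< (position<N v)

  abstract
    -- Abstract, so that `decode` does not unfold; what follows relies on the equation for the
    -- position only.
    decodeWithPosition : ∀ (i : Fin (vertexCount n d)) → Σ Vertex λ v → toℕ i ≡ position v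
    decodeWithPosition i =
      let ℓ , y , ℓ<sd , y<lay , eq  = partialSum-find (layerCount n) (suc d) (toℕ<n i)
          h , u , h<sn , u<blk , eq' = partialSum-find (blockSize ℓ) (suc n) y<lay
          ℓ≤h , u≤h                  = <blockSize⇒≤ {ℓ} u<blk
      in  vertex ℓ h u (≤-pred ℓ<sd) ℓ≤h (≤-pred h<sn) u≤h
        , ≡.trans eq (≡.cong (partialSum (layerCount n) ℓ +_) eq')

  decode : Fin (vertexCount n d) → Vertex
  decode i = proj₁ (decodeWithPosition i)

  toℕ-decode : ∀ i → toℕ i ≡ position (decode i)
  toℕ-decode i = proj₂ (decodeWithPosition i)

  -- Both vertices have the same position. Only coordinates are compared, so proofs of the
  -- inequalities need not be identified.
  decode-encode : ∀ v → level (decode (encode v)) ≡ level v ×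
    head (decode (encode v)) ≡ head v × current (decode (encode v)) ≡ current v
  decode-encode v = position-injective (decode (encode v)) v
    (≡.trans (≡.sym (toℕ-decode (encode v))) (toℕ-encode v))

  layerOf : Fin (vertexCount n d) → ℕ
  layerOf i = level (decode i)

  layerOf-encode : ∀ v → layerOf (encode v) ≡ level v
  layerOf-encode v = proj₁ (decode-encode v)

  layer-interval : ∀ ℓ i → layerOf i ≡ ℓ →
    partialSum (layerCount n) ℓ ≤ toℕ i × toℕ i < partialSum (layerCount n) ℓ + layerCount n ℓ
  layer-interval _ i ≡.refl =
    ≡.subst (λ t → s ≤ t × t < s + layerCount n (layerOf i)) (≡.sym (toℕ-decode i))
      (m≤m+n s _ , +-monoʳ-< s (offset<layerCount (decode i)))
    where s = partialSum (layerCount n) (layerOf i)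

  layer-length : ∀ ℓ →
    length (filter (λ i → layerOf i ≟ ℓ) (allFin (vertexCount n d))) ≤ layerCount n ℓ
  layer-length ℓ = length-filter-interval (λ i → layerOf i ≟ ℓ) _ id _ _ (layer-interval ℓ)

-- The branching program and its correctness.

module Program {c ℓ} (R : CommutativeRing c ℓ) (n d : ℕ) where
  private
    module R = CommutativeRing R
    P = polyRing R (Var R n)
  open CommutativeRing P hiding (zero; _+_; _*_)
  open Sums P
  open LinearForms R n
  open Minors P entry
  open Vertices n d
  open Vertex
  open import Relation.Binary.Reasoning.Setoid setoid

  N : ℕ
  N = vertexCount n d

  -- The vertex (k, h, u) carries cpc h k if u = h, and a bordered sum if u < h; the
  -- vertices with k = 0 and u < h carry 0 and have no incoming edges.
  polynomial : ℕ → ℕ → ℕ → Carrier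
  polynomial k h u = if does (u ≟ h) then principal h k else walk k h u

  polynomial-principal : ∀ k h → polynomial k h h ≡ principal h k
  polynomial-principal k h rewrite dec-true (h ≟ h) ≡.refl = ≡.refl

  polynomial-walk : ∀ k {h u} → u ≢ h → polynomial k h u ≡ walk k h u
  polynomial-walk k {h} {u} u≢h rewrite dec-false (u ≟ h) u≢h = ≡.refl

  polynomialAt : Fin N → Carrier
  polynomialAt i = polynomial (level (decode i)) (head (decode i)) (current (decode i))

  polynomialAt-encode : ∀ v → polynomialAt (encode v) ≡ polynomial (level v) (head v) (current v)
  polynomialAt-encode v with decode (encode v) | decode-encode v
  ... | _ | ≡.refl , ≡.refl , ≡.refl = ≡.refl

  srcVertex : Vertex
  srcVertex = vertex 0 0 0 z≤n z≤n z≤n z≤n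

  src : Fin N
  src = encode srcVertex

  initial : Fin N → Carrier
  initial i = if does (i ≟F src) then 1# else 0#

  initial-≢ : ∀ i {v} → decode i ≡ v → (head v ≡ 0 → current v ≡ 0 → ⊥) → initial i ≈ 0#
  initial-≢ i ≡.refl v≢0 = reflexive
    (≡.cong (if_then 1# else 0#) (dec-false (i ≟F src) λ { ≡.refl →
      let _ , h≡0 , u≡0 = decode-encode srcVertex in v≢0 h≡0 u≡0 }))

  initial-≡ : ∀ i {v} → decode i ≡ v → level v ≡ 0 → head v ≡ 0 → current v ≡ 0 → initial i ≈ 1#
  initial-≡ i ≡.refl l≡0 h≡0 u≡0 = reflexive (≡.cong (if_then 1# else 0#) (dec-true (i ≟F src)
    (toℕ-injective (≡.trans (toℕ-decode i) (≡.trans positions (≡.sym (toℕ-encode srcVertex)))))))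
    where
    positions : position (decode i) ≡ 0
    positions rewrite l≡0 | h≡0 | u≡0 = ≡.refl

  ABPEdge : Set c
  ABPEdge = Edge R n N layerOf

  -- Edges into `i` bundled with a proof that they contribute `p` when all sources carry their
  -- intended polynomials. Edge lists are thereby assembled along the right-hand sides of the
  -- recursions.
  record Incoming (i : Fin N) (p : Carrier) : Set (c ⊔ ℓ) where
    field
      edges   : List ABPEdge
      targets : All (λ e → target R e ≡ i) edges
      carries : ∑ edges (λ e → label R e ⊗ polynomialAt (source R e)) ≈ p
  open Incoming

  none : ∀ {i} → Incoming i 0#
  none = record { edges = [] ; targets = [] ; carries = refl }

  infixr 5 _⊎_
  _⊎_ : ∀ {i p q} → Incoming i p → Incoming i q → Incoming i (p ⊕ q)
  es ⊎ fs = record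
    { edges   = edges es ++ edges fs
    ; targets = ++⁺ (targets es) (targets fs)
    ; carries = trans (∑-++ (edges es) (edges fs) _) (+-cong (carries es) (carries fs))
    }

  cast : ∀ {i p q} → p ≈ q → Incoming i p → Incoming i q
  cast p≈q es = record { edges = edges es ; targets = targets es ; carries = trans (carries es) p≈q }

  private
    before : ∀ v i → position v < position (decode i) → toℕ (encode v) < toℕ i
    before v i = ≡.subst₂ _<_ (≡.sym (toℕ-encode v)) (≡.sym (toℕ-decode i))

  constIn : ∀ i v → level v ≡ layerOf i → head v < head (decode i) →
    Incoming i (polynomial (level v) (head v) (current v))
  constIn i v lv hd = record
    { edges   = constEdge (encode v) i (before v i (position-head-< v (decode i) lv hd))
                  (≡.trans (layerOf-encode v) lv) R.1# ∷ []
    ; targets = ≡.refl ∷ []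
    ; carries = trans (+-identityʳ _) (trans (*-identityˡ _) (reflexive (polynomialAt-encode v)))
    }

  linIn : ∀ i v → layerOf i ≡ suc (level v) → ∀ a →
    Incoming i (linForm R a ⊗ polynomial (level v) (head v) (current v))
  linIn i v lv a = record
    { edges   = linEdge (encode v) i
                  (before v i (position-level-< v (decode i) (≤-reflexive (≡.sym lv))))
                  (≡.trans lv (≡.cong suc (≡.sym (layerOf-encode v)))) a ∷ []
    ; targets = ≡.refl ∷ []
    ; carries = trans (+-identityʳ _) (*-congˡ (reflexive (polynomialAt-encode v)))
    }

  module _ (i : Fin N) {k h : ℕ} (k≤d : k ≤ d) (k≤h : k ≤ h) (h≤n : h ≤ n)
           (lv : layerOf i ≡ suc k) (col : ℕ) where

    walksIn : ∀ m → m ≤ h → Incoming i (∑ (downFrom m) (λ u → - entry u col ⊗ walk k h u))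
    walksIn zero    _   = none
    walksIn (suc u) u<h =
      -- The sign of the recursion is put into the coefficients of the label; since `u` is below
      -- `h`, the source carries a walk and not a principal sum.
      cast (*-cong (linForm-neg _) (reflexive (polynomial-walk k (<⇒≢ u<h))))
        (linIn i (vertex k h u k≤d k≤h h≤n (<⇒≤ u<h)) lv (λ a b → R.- unit u col a b))
      ⊎ walksIn u (<⇒≤ u<h)

    borderedIn : Incoming i (bordered k h col)
    borderedIn = cast (sym (bordered-rec k h col))
      (cast (*-congˡ (reflexive (polynomial-principal k h)))
         (linIn i (vertex k h h k≤d k≤h h≤n ≤-refl) lv (unit h col))
       ⊎ walksIn h ≤-refl)

  -- If `k` exceeds `h`, the source has been dropped from the program, but then the principal sum is
  -- zero and no edge is required.
  principalIn : ∀ i {k h} → k ≤ d → h ≤ n → k ≡ layerOf i → h < head (decode i) →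
    Incoming i (principal h k)
  principalIn i {k} {h} k≤d h≤n lv hd with k ≤? h
  ... | yes k≤h = cast (reflexive (polynomial-principal k h))
                    (constIn i (vertex k h h k≤d k≤h h≤n ≤-refl) lv hd)
  ... | no  k≰h = cast (sym (principal-zero (≰⇒> k≰h))) none

  private
    not-src : ∀ {a p q : Carrier} → a ≈ 0# → p ≈ q → p ≈ a ⊕ q
    not-src a≈0 p≈q = trans p≈q (trans (sym (+-identityˡ _)) (+-congʳ (sym a≈0)))

  incoming : ∀ i → Σ Carrier λ p → Incoming i p × polynomialAt i ≈ initial i ⊕ p
  incoming i = go (decode i) ≡.refl
    where
    go : ∀ v → decode i ≡ v →
      Σ Carrier λ p → Incoming i p × polynomial (level v) (head v) (current v) ≈ initial i ⊕ p
    go (vertex k h u k≤d k≤h h≤n u≤h) eq with u ≟ h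
    go (vertex zero h u k≤d k≤h h≤n u≤h) eq | no u≢h =
      0# , none , not-src (initial-≢ i eq λ h≡0 u≡0 → u≢h (≡.trans u≡0 (≡.sym h≡0)))
                          (reflexive (polynomial-walk 0 u≢h))
    go (vertex (suc k) h u k≤d k≤h h≤n u≤h) eq | no u≢h =
      bordered k h u , borderedIn i (<⇒≤ k≤d) (<⇒≤ k≤h) h≤n (≡.cong level eq) u ,
      not-src (initial-≢ i eq λ h≡0 u≡0 → u≢h (≡.trans u≡0 (≡.sym h≡0)))
              (reflexive (polynomial-walk (suc k) u≢h))
    -- The source: its only minor is the empty one, so `principal 0 0` unfolds to one plus zero, and
    -- the empty path supplies the one.
    go (vertex zero zero _ k≤d k≤h h≤n u≤h) eq | yes ≡.refl =
      0# , none , +-congʳ (sym (initial-≡ i eq ≡.refl ≡.refl ≡.refl))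
    -- In degree 0 the value one is handed on from head `h` to head `suc h`; both principal sums
    -- unfold to the same term.
    go (vertex zero (suc h) _ k≤d k≤h h≤n u≤h) eq | yes ≡.refl =
      principal h 0 ,
      principalIn i k≤d (<⇒≤ h≤n) (≡.sym (≡.cong level eq)) (≤-reflexive (≡.sym (≡.cong head eq))) ,
      not-src (initial-≢ i eq λ ()) (reflexive (polynomial-principal 0 (suc h)))
    -- `bordered k h h` has no vertex of its own; the edges of its recursion lead directly into the
    -- principal sum of head `suc h`.
    go (vertex (suc k) (suc h) _ k≤d k≤h h≤n u≤h) eq | yes ≡.refl =
      principal h (suc k) ⊕ bordered k h h ,
      principalIn i k≤d (<⇒≤ h≤n) (≡.sym (≡.cong level eq)) (≤-reflexive (≡.sym (≡.cong head eq)))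
      ⊎ borderedIn i (<⇒≤ k≤d) (≤-pred k≤h) (<⇒≤ h≤n) (≡.cong level eq) h ,
      not-src (initial-≢ i eq λ ())
              (trans (reflexive (polynomial-principal (suc k) (suc h))) (principal-rec h k))

  edgesInto : Fin N → List ABPEdge
  edgesInto i = edges (proj₁ (proj₂ (incoming i)))

  program : ABP R n
  program = record
    { D         = d
    ; N         = N
    ; layer     = layerOf
    ; layer≤D   = λ i → level≤d (decode i)
    ; src       = src
    ; src-layer = layerOf-encode srcVertex
    ; edges     = concatMap edgesInto (allFin N)
    }

  program-value : ∀ v → ABP.value program (encode v) ≈ polynomial (level v) (head v) (current v)
  program-value v = trans
    (Evaluation.value-unique R program edgesInto
      (λ i → targets (proj₁ (proj₂ (incoming i)))) ≡.refl
      (λ i → let _ , es , rec = incoming i in trans rec (+-congˡ (sym (carries es))))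
      (encode v))
    (reflexive (polynomialAt-encode v))

  program-computes : d ≤ n → ∀ n' d' (n'≤n : n' ≤ n) → d' ≤ d →
    ComputesAlong R program (cpc R n n' d' n'≤n)
  program-computes d≤n n' d' n'≤n d'≤d with d' ≤? n'
  ... | yes d'≤n' = encode v , (begin
      ABP.value program (encode v)  ≈⟨ program-value v ⟩
      polynomial d' n' n'           ≡⟨ polynomial-principal d' n' ⟩
      principal n' d'               ≈⟨ cpc-principal n' d' n'≤n ⟨
      cpc R n n' d' n'≤n            ∎)
    where
    v : Vertex
    v = vertex d' n' n' d'≤d d'≤n' n'≤n ≤-refl
  -- The polynomial is zero and its vertex has been dropped. The vertex (0, n, 0) carries zero
  -- instead; it differs from the source because `n` is positive here.
  ... | no  d'≰n' = encode v , (begin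
      ABP.value program (encode v)  ≈⟨ program-value v ⟩
      polynomial 0 n 0              ≡⟨ polynomial-walk 0 (<⇒≢ 0<n) ⟩
      0#                            ≈⟨ principal-zero (≰⇒> d'≰n') ⟨
      principal n' d'               ≈⟨ cpc-principal n' d' n'≤n ⟨
      cpc R n n' d' n'≤n            ∎)
    where
    0<n : 0 < n
    0<n = ≤-trans (≤-trans (s≤s z≤n) (≰⇒> d'≰n')) (≤-trans d'≤d d≤n)
    v : Vertex
    v = vertex 0 n 0 z≤n z≤n ≤-refl z≤n

theorem6p1 : ∀ {c ℓ} → Σ ℕ λ C → (R : CommutativeRing c ℓ) → (n d : ℕ) → d ≤ n →
    Σ (ABP R n) λ A →
    (∀ n' d' → (p : n' ≤ n) → d' ≤ d → ComputesAlong R A (cpc R n n' d' p))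
    × (∀ i → 1 ≤ i → i < ABP.D A → 2 * ABP.layerSize A i ≤ n * n + C * suc n)
    × (6 * ABP.N A + d ^ 3 ≤ 3 * d * (n * n) + C * (suc n * suc n))
    × (3 * d * (n * n) ≤ 6 * ABP.N A + d ^ 3 + C * (suc n * suc n))
-- The constant comes from `vertexCount-upper`: for d equal to n, 3(d+1)(n+1)(n+2) exceeds 3dn² by
-- 12n² plus lower-order terms.
theorem6p1 = 12 , λ R n d d≤n →
  let open Program R n d in
  program ,
  program-computes d≤n ,
  (λ i _ i<d → ≤-trans (*-monoʳ-≤ 2 (Vertices.layer-length n d i))
                       (layerCount-bound n i (≤-trans (<⇒≤ i<d) d≤n))) ,
  vertexCount-upper n d d≤n ,
  vertexCount-lower n d d≤n
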